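{- For every integer $n \geq 2$, let $G_n$ be the graph with vertex set $V(G_n) = \{u_0, \ldots, u_n\} \cup \{x_i, y_i, z_i : 1 \le i \le n-1\}$ (all these vertices distinct) and with exactly the following edges: $u_i u_{i+1}$ for $i \in \{0,\ldots,n-1\}$, and $u_i x_i$, $x_i y_i$, $y_i z_i$, $u_{i+1}x_i$, $u_{i+1}y_i$, $u_{i+1}z_i$ for $i \in \{1,\ldots,n-1\}$. Then $\gamma_{cg}(G_n) = n$.
   Context: The connected domination game on a graph $G$ is played by two players, Dominator and Staller, who alternately select vertices. A vertex $w$ is a legal move if (a) its closed neighborhood $N[w]$ contains at least one vertex not in the union of the closed neighborhoods of the previously selected vertices (i.e. it dominates a new vertex), and (b) unless it is the first move, $w$ is adjacent to at least one already selected vertex. The game ends when no legal move exists; on a connected graph the selected vertices then form a connected dominating set. Dominator wants to minimize the total number of moves, Staller wants to maximize it. $\gamma_{cg}(G)$ is the number of moves under optimal play when Dominator moves first (D-game). -}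

module Defs where

open import Data.Empty using (⊥-elim)
open import Data.Fin using (Fin; toℕ)
import Data.Fin.Properties as Fin
open import Data.List using (List; []; _∷_; _++_; map; filter; foldr; length; allFin)
open import Data.List.Membership.Propositional using (_∈_; lose)
open import Data.List.Membership.Propositional.Properties
  using (∈-++⁺ˡ; ∈-++⁺ʳ; ∈-map⁺; ∈-allFin; ∈-filter⁻)
open import Data.List.Properties using (map-cong-local; length-filter)
open import Data.List.Relation.Unary.All using (tabulate)
open import Data.List.Relation.Unary.Any using (Any; here; there; any?; satisfied)
open import Data.List.Relation.Unary.Enumerates.Setoid using (IsEnumeration)
open import Data.Nat using (ℕ; zero; suc; _+_; _∸_; _⊓_; _⊔_; _≤_; _<_; z≤n; s≤s; s≤s⁻¹)
open import Data.Nat.Properties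
  using (≤-trans; m≤n⇒m≤1+n; 1+n≢n; n≮0)
  renaming (_≟_ to _≟ℕ_)
open import Data.Product using (_×_; _,_; ∃; proj₂)
open import Data.Sum using (_⊎_; inj₁; inj₂)
open import Function using (_∘_)
open import Relation.Binary using (Rel; Symmetric; Irreflexive; DecidableEquality)
  renaming (Decidable to Decidable₂)
open import Relation.Binary.Construct.Closure.Symmetric using (SymClosure; fwd; bwd; symmetric)
open import Relation.Binary.PropositionalEquality
  using (_≡_; refl; sym; cong; setoid)
open import Relation.Nullary using (¬_; Dec; yes; no; contradiction)
open import Relation.Nullary.Decidable using (map′; _×-dec_; _⊎-dec_; ¬?)
open import Relation.Unary using (Decidable)

------------------------------------------------------------------------
-- Finite simple graphs

record FiniteGraph : Set₁ where
  field
    Vertex   : Set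
    _≟_      : DecidableEquality Vertex
    vertices : List Vertex
    complete : IsEnumeration (setoid Vertex) vertices
    Adj      : Rel Vertex _
    adj?     : Decidable₂ Adj
    adj-sym  : Symmetric Adj
    adj-irr  : Irreflexive _≡_ Adj

------------------------------------------------------------------------
-- The connected domination game

data Player : Set where
  dominator staller : Player

opponent : Player → Player
opponent dominator = staller
opponent staller   = dominator

prefer : Player → ℕ → ℕ → ℕ
prefer dominator = _⊓_
prefer staller   = _⊔_

module _ {A : Set} {P Q : A → Set} (P? : Decidable P) (Q? : Decidable Q)
         (P⊆Q : ∀ {a} → P a → Q a) where

  filter-≤ : ∀ as → length (filter P? as) ≤ length (filter Q? as)
  filter-≤ []       = z≤n
  filter-≤ (a ∷ as) with P? a | Q? a
  ... | yes _ | yes _ = s≤s (filter-≤ as)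
  ... | yes p | no ¬q = contradiction (P⊆Q p) ¬q
  ... | no _  | yes _ = m≤n⇒m≤1+n (filter-≤ as)
  ... | no _  | no _  = filter-≤ as

  filter-< : ∀ {a as} → a ∈ as → Q a → ¬ P a →
             length (filter P? as) < length (filter Q? as)
  filter-< {a} {_ ∷ as} (here refl) q ¬p with P? a | Q? a
  ... | yes p | _     = contradiction p ¬p
  ... | no _  | yes _ = s≤s (filter-≤ as)
  ... | no _  | no ¬q = contradiction q ¬q
  filter-< {as = b ∷ as} (there a∈as) q ¬p with P? b | Q? b
  ... | yes _ | yes _  = s≤s (filter-< a∈as q ¬p)
  ... | yes p | no ¬q  = contradiction (P⊆Q p) ¬q
  ... | no _  | yes _  = m≤n⇒m≤1+n (filter-< a∈as q ¬p)
  ... | no _  | no _   = filter-< a∈as q ¬p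

module Game (G : FiniteGraph) where
  open FiniteGraph G

  -- The vertices selected so far, most recent first.
  Position : Set
  Position = List Vertex

  _∈N[_] : Vertex → Vertex → Set
  v ∈N[ w ] = v ≡ w ⊎ Adj w v

  Dominated : Position → Vertex → Set
  Dominated S v = Any (v ∈N[_]) S

  Legal : Position → Vertex → Set
  Legal S w = (∃ λ v → v ∈N[ w ] × ¬ Dominated S v)
            × (S ≡ [] ⊎ Any (Adj w) S)

  _∈N?[_] : ∀ v w → Dec (v ∈N[ w ])
  v ∈N?[ w ] = (v ≟ w) ⊎-dec adj? w v

  dominated? : ∀ S → Decidable (Dominated S)
  dominated? S v = any? (v ∈N?[_]) S

  empty? : (S : Position) → Dec (S ≡ [])
  empty? []      = yes refl
  empty? (_ ∷ _) = no λ ()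

  legal? : ∀ S → Decidable (Legal S)
  legal? S w =
    map′ satisfied (λ (v , p) → lose (complete v) p)
         (any? (λ v → (v ∈N?[ w ]) ×-dec ¬? (dominated? S v)) vertices)
    ×-dec (empty? S ⊎-dec any? (adj? w) S)

  legalMoves : Position → List Vertex
  legalMoves S = filter (legal? S) vertices

  -- The minimax value of a list of options, given as the number of further
  -- moves each leads to; no options means that the game has ended.
  optimum : Player → List ℕ → ℕ
  optimum p []       = 0
  optimum p (k ∷ ks) = suc (foldr (prefer p) k ks)

  -- The number of further moves under optimal play from S with p to move,
  -- cut off after at most the number of moves given as first argument.
  play : ℕ → Player → Position → ℕ
  play zero    p S = 0
  play (suc f) p S =
    optimum p (map (λ w → play f (opponent p) (w ∷ S)) (legalMoves S))

  -- Every move dominates a new vertex, so no game is longer than the number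
  -- of vertices and the cut-off has no effect (see γcg-cutoff below).
  γcg : ℕ
  γcg = play (length vertices) dominator []

  undominated : Position → List Vertex → ℕ
  undominated S vs = length (filter (λ v → ¬? (dominated? S v)) vs)

  legal⇒< : ∀ S w → Legal S w → undominated (w ∷ S) vertices < undominated S vertices
  legal⇒< S w ((v , v∈N , ¬d) , _) =
    filter-< (λ v → ¬? (dominated? (w ∷ S) v)) (λ v → ¬? (dominated? S v))
      (λ ¬d′ → ¬d′ ∘ there) (complete v) ¬d (λ ¬d′ → ¬d′ (here v∈N))

  play-cutoff : ∀ f k p S → undominated S vertices ≤ f → play (f + k) p S ≡ play f p S
  play-cutoff zero    zero    p S _ = refl
  play-cutoff zero    (suc k) p S le = noMoves (legalMoves S) refl
    where
    noMoves : ∀ ms → legalMoves S ≡ ms →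
              optimum p (map (λ w → play k (opponent p) (w ∷ S)) ms) ≡ 0
    noMoves []       _  = refl
    noMoves (m ∷ ms) eq = ⊥-elim (n≮0 (≤-trans (legal⇒< S m (legal (here refl) eq)) le))
      where
      legal : ∀ {w ws} → w ∈ ws → legalMoves S ≡ ws → Legal S w
      legal w∈ refl = proj₂ (∈-filter⁻ (legal? S) {xs = vertices} w∈)
  play-cutoff (suc f) k p S le =
    cong (optimum p) (map-cong-local (tabulate λ {w} w∈ →
      play-cutoff f k (opponent p) (w ∷ S)
        (s≤s⁻¹ (≤-trans
          (legal⇒< S w (proj₂ (∈-filter⁻ (legal? S) {xs = vertices} w∈))) le))))

  γcg-cutoff : ∀ k → play (length vertices + k) dominator [] ≡ γcg
  γcg-cutoff k =
    play-cutoff (length vertices) k dominator [] (length-filter _ vertices)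

open Game public using (γcg)

------------------------------------------------------------------------
-- The graphs Gₙ

-- The argument k of x, y and z stands for the subscript suc (toℕ k), so that
-- subscripts range over 1, …, n ∸ 1.
data V (n : ℕ) : Set where
  u     : Fin (suc n) → V n
  x y z : Fin (n ∸ 1) → V n

index : ∀ {m} → Fin m → ℕ
index k = suc (toℕ k)

data Edge {n : ℕ} : V n → V n → Set where
  uu  : ∀ {i j} → toℕ j ≡ suc (toℕ i)   → Edge (u i) (u j)
  ux  : ∀ {i k} → toℕ i ≡ index k       → Edge (u i) (x k)
  xy  : ∀ {k}                           → Edge (x k) (y k)
  yz  : ∀ {k}                           → Edge (y k) (z k)
  u⁺x : ∀ {i k} → toℕ i ≡ suc (index k) → Edge (u i) (x k)
  u⁺y : ∀ {i k} → toℕ i ≡ suc (index k) → Edge (u i) (y k)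
  u⁺z : ∀ {i k} → toℕ i ≡ suc (index k) → Edge (u i) (z k)

edge? : ∀ {n} → Decidable₂ (Edge {n})
edge? (u i) (u j) = map′ uu (λ { (uu e) → e }) (toℕ j ≟ℕ suc (toℕ i))
edge? (u i) (x k) =
  map′ (λ { (inj₁ e) → ux e ; (inj₂ e) → u⁺x e })
       (λ { (ux e) → inj₁ e ; (u⁺x e) → inj₂ e })
       ((toℕ i ≟ℕ index k) ⊎-dec (toℕ i ≟ℕ suc (index k)))
edge? (u i) (y k) = map′ u⁺y (λ { (u⁺y e) → e }) (toℕ i ≟ℕ suc (index k))
edge? (u i) (z k) = map′ u⁺z (λ { (u⁺z e) → e }) (toℕ i ≟ℕ suc (index k))
edge? (x k) (y l) = map′ (λ { refl → xy }) (λ { xy → refl }) (k Fin.≟ l)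
edge? (y k) (z l) = map′ (λ { refl → yz }) (λ { yz → refl }) (k Fin.≟ l)
edge? (x _) (u _) = no λ ()
edge? (x _) (x _) = no λ ()
edge? (x _) (z _) = no λ ()
edge? (y _) (u _) = no λ ()
edge? (y _) (x _) = no λ ()
edge? (y _) (y _) = no λ ()
edge? (z _) (u _) = no λ ()
edge? (z _) (x _) = no λ ()
edge? (z _) (y _) = no λ ()
edge? (z _) (z _) = no λ ()

_≟V_ : ∀ {n} → DecidableEquality (V n)
u i ≟V u j = map′ (cong u) (λ { refl → refl }) (i Fin.≟ j)
u _ ≟V x _ = no λ ()
u _ ≟V y _ = no λ ()
u _ ≟V z _ = no λ ()
x _ ≟V u _ = no λ ()
x i ≟V x j = map′ (cong x) (λ { refl → refl }) (i Fin.≟ j)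
x _ ≟V y _ = no λ ()
x _ ≟V z _ = no λ ()
y _ ≟V u _ = no λ ()
y _ ≟V x _ = no λ ()
y i ≟V y j = map′ (cong y) (λ { refl → refl }) (i Fin.≟ j)
y _ ≟V z _ = no λ ()
z _ ≟V u _ = no λ ()
z _ ≟V x _ = no λ ()
z _ ≟V y _ = no λ ()
z i ≟V z j = map′ (cong z) (λ { refl → refl }) (i Fin.≟ j)

allV : ∀ n → List (V n)
allV n = map u (allFin (suc n))
      ++ map x (allFin (n ∸ 1))
      ++ map y (allFin (n ∸ 1))
      ++ map z (allFin (n ∸ 1))

allV-complete : ∀ n → IsEnumeration (setoid (V n)) (allV n)
allV-complete n (u i) = ∈-++⁺ˡ (∈-map⁺ u (∈-allFin i))
allV-complete n (x k) =
  ∈-++⁺ʳ (map u (allFin (suc n))) (∈-++⁺ˡ (∈-map⁺ x (∈-allFin k)))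
allV-complete n (y k) =
  ∈-++⁺ʳ (map u (allFin (suc n))) (∈-++⁺ʳ (map x (allFin (n ∸ 1)))
    (∈-++⁺ˡ (∈-map⁺ y (∈-allFin k))))
allV-complete n (z k) =
  ∈-++⁺ʳ (map u (allFin (suc n))) (∈-++⁺ʳ (map x (allFin (n ∸ 1)))
    (∈-++⁺ʳ (map y (allFin (n ∸ 1))) (∈-map⁺ z (∈-allFin k))))

edge-irr : ∀ {n} {v : V n} → ¬ Edge v v
edge-irr (uu e) = 1+n≢n (sym e)

G : ℕ → FiniteGraph
G n = record
  { Vertex   = V n
  ; _≟_      = _≟V_
  ; vertices = allV n
  ; complete = allV-complete n
  ; Adj      = SymClosure Edge
  ; adj?     = λ v w → map′ (λ { (inj₁ e) → fwd e ; (inj₂ e) → bwd e })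
                            (λ { (fwd e) → inj₁ e ; (bwd e) → inj₂ e })
                            (edge? v w ⊎-dec edge? w v)
  ; adj-sym  = symmetric Edge
  ; adj-irr  = λ { refl (fwd e) → edge-irr e ; refl (bwd e) → edge-irr e }
  }

{-# OPTIONS --safe #-}

-- The closed neighbourhoods of u₀, z₁, …, zₙ₋₁ are pairwise disjoint, so n
-- moves are needed to dominate Gₙ; and as Gₙ is connected, the game does not
-- stop before everything is dominated. Conversely, if Dominator starts with uₙ,
-- then every later move is forced: uₙ₋₁, uₙ₋₂, …, u₁.

module Submission where

open import Defs
open import Data.Fin using (Fin; zero; suc; toℕ; fromℕ; fromℕ<)
open import Data.Fin.Induction using (<-weakInduction)
open import Data.Fin.Properties
  using (¬∀⟶∃¬; pigeonhole; toℕ-fromℕ; toℕ-fromℕ<; toℕ-inject₁; toℕ-injective; toℕ<n)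
  renaming (<⇒≢ to <⇒≢ꟳ)
open import Data.List using ([]; _∷_; map; length; lookup; allFin)
open import Data.List.Membership.Propositional using (_∈_; find; lose)
open import Data.List.Membership.Propositional.Properties using (∈-map⁺; ∈-filter⁺; ∈-filter⁻)
open import Data.List.Properties
  using (foldr-preservesᵇ; foldr-preservesᵒ; length-++; length-map; length-tabulate)
open import Data.List.Relation.Unary.All as All using (All; []; _∷_)
import Data.List.Relation.Unary.All.Properties as All
open import Data.List.Relation.Unary.Any as Any using (Any; here; there)
open import Data.List.Relation.Unary.Any.Properties using (lookup-index)
open import Data.Nat using (ℕ; zero; suc; pred; _+_; _⊓_; _⊔_; _≤_; _<_; z≤n; s≤s; s≤s⁻¹)
open import Data.Nat.Properties
open import Data.Product using (_×_; _,_; ∃; proj₁; proj₂)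
open import Data.Sum using (_⊎_; inj₁; inj₂; [_,_])
open import Function using (_∘_; id)
open import Relation.Binary.Construct.Closure.Equivalence using (EqClosure)
  renaming (symmetric to EqClosure-sym)
open import Relation.Binary.Construct.Closure.ReflexiveTransitive using (Star; ε; _◅_; _◅◅_)
open import Relation.Binary.Construct.Closure.Symmetric using (fwd; bwd)
  renaming (symmetric to SymClosure-sym)
open import Relation.Binary.PropositionalEquality
  using (_≡_; refl; sym; trans; cong; subst)
open import Relation.Nullary using (¬_; yes; no; contradiction)
open import Relation.Unary using (Decidable)

-- `_⊓_` and `_⊔_` each return one of their two arguments. Thanks to this, most bounds below treat
-- both players at once.
prefer-preserves : ∀ (P : ℕ → Set) p {a b} → P a → P b → P (prefer p a b)
prefer-preserves P dominator {a} {b} pa pb with a ⊓ b | ⊓-sel a b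
... | _ | inj₁ refl = pa
... | _ | inj₂ refl = pb
prefer-preserves P staller   {a} {b} pa pb with a ⊔ b | ⊔-sel a b
... | _ | inj₁ refl = pa
... | _ | inj₂ refl = pb

crossing : ∀ {A : Set} {R : A → A → Set} {P : A → Set} → Decidable P →
           ∀ {a b} → Star R a b → P a → ¬ P b → ∃ λ c → ∃ λ d → R c d × P c × ¬ P d
crossing P? ε                  pa ¬pb = contradiction pa ¬pb
crossing P? (_◅_ {j = c} r rs) pa ¬pb with P? c
... | yes pc = crossing P? rs pc ¬pb
... | no ¬pc = _ , _ , r , pa , ¬pc

-- Bounds on the game on an arbitrary finite graph.

module _ (Γ : FiniteGraph) where
  open FiniteGraph Γ
  open Game Γ hiding (γcg)

  optimum-≤ : ∀ p {c ks} → All (_< c) ks → optimum p ks ≤ c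
  optimum-≤ p []           = z≤n
  optimum-≤ p (k<c ∷ ks<c) = foldr-preservesᵇ (prefer-preserves (_< _) p) k<c ks<c

  -- The member `k` excludes the empty list, whose optimum is 0; the move being made makes the bound
  -- strict.
  optimum-> : ∀ p {c k ks} → k ∈ ks → All (c ≤_) ks → c < optimum p ks
  optimum-> p {ks = _ ∷ _} _ (c≤k ∷ c≤ks) =
    s≤s (foldr-preservesᵇ (prefer-preserves (_ ≤_) p) c≤k c≤ks)

  optimum-dominator-≤ : ∀ {k ks} → k ∈ ks → optimum dominator ks ≤ suc k
  optimum-dominator-≤ {k} {k₀ ∷ ks} k∈ = s≤s (foldr-preservesᵒ
    (λ a b → [ ≤-trans (m⊓n≤m a b) , ≤-trans (m⊓n≤n a b) ]) k₀ ks (toSum k∈))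
    where
    toSum : k ∈ (k₀ ∷ ks) → k₀ ≤ k ⊎ Any (_≤ k) ks
    toSum (here refl) = inj₁ ≤-refl
    toSum (there k∈)  = inj₂ (Any.map (≤-reflexive ∘ sym) k∈)

  ∈legalMoves : ∀ {S w} → Legal S w → w ∈ legalMoves S
  ∈legalMoves {S} {w} = ∈-filter⁺ (legal? S) (complete w)

  All-options : ∀ {P : ℕ → Set} {S} {g : Vertex → ℕ} → (∀ {w} → Legal S w → P (g w)) →
                All P (map g (legalMoves S))
  All-options {S = S} h =
    All.map⁺ (All.tabulate (h ∘ proj₂ ∘ ∈-filter⁻ (legal? S) {xs = vertices}))

  -- On a path from a selected vertex to an undominated one, some edge leads from a dominated `c` to
  -- an undominated `d`. Here `c` is not selected itself, as `d` would then be dominated, so `c` has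
  -- a selected neighbour and is a legal move.
  legal-exists : (∀ a b → Star Adj a b) → ∀ S v → ¬ Dominated S v → ∃ (Legal S)
  legal-exists conn []       v _  = v , (v , inj₁ refl , λ ()) , inj₁ refl
  legal-exists conn S@(s ∷ _) v ¬d
    with crossing (dominated? S) (conn s v) (here (inj₁ refl)) ¬d
  ... | c , d , cd , c-dom , ¬d-dom = c , (d , inj₂ cd , ¬d-dom) , inj₂ (adjacent c-dom ¬d-dom)
    where
    adjacent : ∀ {T} → Dominated T c → ¬ Dominated T d → Any (Adj c) T
    adjacent (here (inj₁ refl)) ¬d = contradiction (here (inj₂ cd)) ¬d
    adjacent (here (inj₂ tc))   ¬d = here (adj-sym tc)
    adjacent (there c-dom)      ¬d = there (adjacent c-dom (¬d ∘ there))

  -- A selected vertex dominates at most one `t i`; the pigeonhole principle is applied to the map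
  -- from `i` to the place in `S` of a vertex dominating `t i`.
  packing⇒undominated : ∀ {n} (t : Fin n → Vertex) →
    (∀ {w i j} → t i ∈N[ w ] → t j ∈N[ w ] → i ≡ j) →
    ∀ S → length S < n → ∃ λ i → ¬ Dominated S (t i)
  packing⇒undominated {n} t disjoint S S<n = ¬∀⟶∃¬ n _ (dominated? S ∘ t) ¬all
    where
    ¬all : ¬ (∀ i → Dominated S (t i))
    ¬all dom with pigeonhole S<n (Any.index ∘ dom)
    ... | i , j , i<j , same = <⇒≢ꟳ i<j (disjoint (lookup-index (dom i))
      (subst (λ s → t j ∈N[ lookup S s ]) (sym same) (lookup-index (dom j))))

  -- While fewer than `n` vertices are selected, some `t i` is undominated and a legal move exists,
  -- whatever the players have chosen. `c` counts the further moves so guaranteed.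
  packing⇒play-≥ : (∀ a b → Star Adj a b) → ∀ {n} (t : Fin n → Vertex) →
    (∀ {w i j} → t i ∈N[ w ] → t j ∈N[ w ] → i ≡ j) →
    ∀ {c f} p S → c ≤ f → c + length S ≤ n → c ≤ play f p S
  packing⇒play-≥ conn t disjoint {zero} p S _ _ = z≤n
  packing⇒play-≥ conn {n} t disjoint {suc c} {suc f} p S (s≤s c≤f) c+S<n =
    optimum-> p (∈-map⁺ _ (∈legalMoves (proj₂ move)))
      (All-options {S = S} λ {w} _ →
        packing⇒play-≥ conn t disjoint (opponent p) (w ∷ S) c≤f
          (subst (_≤ n) (sym (+-suc c (length S))) c+S<n))
    where
    move : ∃ (Legal S)
    move = legal-exists conn S _ (proj₂ (packing⇒undominated t disjoint S
      (≤-trans (s≤s (m≤n+m (length S) c)) c+S<n)))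

-- Connectedness of Gₙ and the packing for the lower bound, with n = `suc m`.

module _ {m : ℕ} where
  open FiniteGraph (G (suc m)) using (Adj)
  open Game (G (suc m)) hiding (γcg)

  connected : ∀ a b → Star Adj a b
  -- `Adj` is `SymClosure Edge`, so `Star Adj` unfolds to the same type as `EqClosure Edge`.
  connected a b = EqClosure-sym Edge (from-u₀ a) ◅◅ from-u₀ b
    where
    to-u : ∀ i → EqClosure Edge (u zero) (u i)
    to-u = <-weakInduction _ ε λ i r → r ◅◅ fwd (uu (cong suc (sym (toℕ-inject₁ i)))) ◅ ε
    from-u₀ : ∀ v → EqClosure Edge (u zero) v
    from-u₀ (u i) = to-u i
    from-u₀ (x k) = to-u (suc (suc k)) ◅◅ fwd (u⁺x refl) ◅ ε
    from-u₀ (y k) = to-u (suc (suc k)) ◅◅ fwd (u⁺y refl) ◅ ε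
    from-u₀ (z k) = to-u (suc (suc k)) ◅◅ fwd (u⁺z refl) ◅ ε

  centre : Fin (suc m) → V (suc m)
  centre zero    = u zero
  centre (suc k) = z k

  -- The value at x is irrelevant: no closed neighbourhood of an x contains a centre.
  colour : V (suc m) → ℕ
  colour (u i) = pred (toℕ i)
  colour (x k) = index k
  colour (y k) = index k
  colour (z k) = index k

  -- N[u₀] consists of u₀ and u₁, and N[zₖ] of zₖ, yₖ and uₖ₊₁; the `pred` in `colour` gives all
  -- members the number of their centre. As `w` has only one colour, it dominates at most one
  -- centre.
  centre-colour : ∀ i {w} → centre i ∈N[ w ] → colour w ≡ toℕ i
  centre-colour zero    (inj₁ refl)          = refl
  centre-colour zero    (inj₂ (fwd (uu ())))
  centre-colour zero    (inj₂ (bwd (uu e)))  = cong pred e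
  centre-colour zero    (inj₂ (bwd (ux ())))
  centre-colour zero    (inj₂ (bwd (u⁺x ())))
  centre-colour zero    (inj₂ (bwd (u⁺y ())))
  centre-colour zero    (inj₂ (bwd (u⁺z ())))
  centre-colour (suc k) (inj₁ refl)          = refl
  centre-colour (suc k) (inj₂ (fwd yz))      = refl
  centre-colour (suc k) (inj₂ (fwd (u⁺z e))) = cong pred e

  centres-disjoint : ∀ {w i j} → centre i ∈N[ w ] → centre j ∈N[ w ] → i ≡ j
  centres-disjoint {i = i} {j} iw jw =
    toℕ-injective (trans (sym (centre-colour i iw)) (centre-colour j jw))

  -- The forced play after the opening move uₙ.

  level : V (suc m) → ℕ
  level (u i) = toℕ i
  level (x k) = index k
  level (y k) = index k
  level (z k) = index k

  -- The edges `ux`, `xy`, `yz` stay within a level; all others join consecutive levels and have a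
  -- `u` at the upper end.
  climb : ∀ {v w} → Adj v w → level v < level w →
          level w ≡ suc (level v) × ∃ λ i → w ≡ u i
  climb (fwd (uu e))  _ = e , _ , refl
  climb (fwd (ux e))  l = contradiction e (<⇒≢ l)
  climb (fwd xy)      l = contradiction refl (<⇒≢ l)
  climb (fwd yz)      l = contradiction refl (<⇒≢ l)
  climb (fwd (u⁺x e)) l = contradiction (≤-trans (n≤1+n _) (≤-reflexive (sym e))) (<⇒≱ l)
  climb (fwd (u⁺y e)) l = contradiction (≤-trans (n≤1+n _) (≤-reflexive (sym e))) (<⇒≱ l)
  climb (fwd (u⁺z e)) l = contradiction (≤-trans (n≤1+n _) (≤-reflexive (sym e))) (<⇒≱ l)
  climb (bwd (uu e))  l = contradiction (≤-trans (n≤1+n _) (≤-reflexive (sym e))) (<⇒≱ l)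
  climb (bwd (ux e))  l = contradiction (sym e) (<⇒≢ l)
  climb (bwd xy)      l = contradiction refl (<⇒≢ l)
  climb (bwd yz)      l = contradiction refl (<⇒≢ l)
  climb (bwd (u⁺x e)) _ = e , _ , refl
  climb (bwd (u⁺y e)) _ = e , _ , refl
  climb (bwd (u⁺z e)) _ = e , _ , refl

  level-adj : ∀ {v w} → Adj v w → level w ≤ suc (level v)
  level-adj {v} {w} vw with level w ≤? level v
  ... | yes w≤v = m≤n⇒m≤1+n w≤v
  ... | no  w≰v = ≤-reflexive (proj₁ (climb vw (≰⇒> w≰v)))

  -- The invariant of the play. The first half shows what is already dominated; the second limits
  -- which vertices are adjacent to a selected one.
  Suffix : ℕ → Position → Set
  Suffix k S = (∀ {i} → k ≤ toℕ i → u i ∈ S) × All (λ w → k ≤ level w) S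

  -- Shows that the position is not empty, so that the next move needs a selected neighbour.
  last∈Suffix : ∀ {k S} → k ≤ suc m → Suffix k S → u (fromℕ (suc m)) ∈ S
  last∈Suffix k≤n (u∈ , _) = u∈ (≤-trans k≤n (≤-reflexive (sym (toℕ-fromℕ _))))

  -- Every vertex except uₙ has a `u` one level higher as neighbour, and uₙ is itself selected. So
  -- domination reaches one level below the selected vertices.
  Suffix-dominates : ∀ {k S v} → k ≤ m → Suffix (suc k) S → k ≤ level v → Dominated S v
  Suffix-dominates {k} {v = u i} k≤m (u∈ , _) k≤i with toℕ i ≤? m
  ... | yes i≤m = lose (u∈ {fromℕ< (s≤s (s≤s i≤m))}
                         (subst (suc k ≤_) (sym (toℕ-fromℕ< (s≤s (s≤s i≤m)))) (s≤s k≤i)))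
                       (inj₂ (bwd (uu (toℕ-fromℕ< (s≤s (s≤s i≤m))))))
  ... | no  i≰m = lose (u∈ (≤-trans (s≤s k≤m) (≰⇒> i≰m))) (inj₁ refl)
  Suffix-dominates {v = x k} _ (u∈ , _) l = lose (u∈ {suc (suc k)} (s≤s l)) (inj₂ (fwd (u⁺x refl)))
  Suffix-dominates {v = y k} _ (u∈ , _) l = lose (u∈ {suc (suc k)} (s≤s l)) (inj₂ (fwd (u⁺y refl)))
  Suffix-dominates {v = z k} _ (u∈ , _) l = lose (u∈ {suc (suc k)} (s≤s l)) (inj₂ (fwd (u⁺z refl)))

  -- The newly dominated `v` lies below level `k`, while a selected neighbour at level above `k`
  -- keeps `w` at level `k` or higher. The edge from `v` to `w` therefore climbs, which leaves only
  -- level `k` and a `u` for `w`.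
  forced : ∀ {k S w} → k ≤ m → Suffix (suc k) S → Legal S w →
           0 < k × ∃ λ i → w ≡ u i × toℕ i ≡ k
  forced {k} {S} {w} k≤m sfx ((v , v∈N , ¬dom) , neighbour) = ≤-<-trans z≤n v<k , at w≡k,u
    where
    v<k : level v < k
    v<k = ≰⇒> (¬dom ∘ Suffix-dominates k≤m sfx)
    k≤w : (S ≡ [] ⊎ Any (Adj w) S) → k ≤ level w
    k≤w (inj₁ refl) with () ← last∈Suffix (s≤s k≤m) sfx
    k≤w (inj₂ any) with find any
    ... | s , s∈S , ws = s≤s⁻¹ (≤-trans (All.lookup (proj₂ sfx) s∈S) (level-adj ws))
    v<w : level v < level w
    v<w = ≤-trans v<k (k≤w neighbour)
    vw : v ∈N[ w ] → Adj v w
    vw (inj₁ refl) = contradiction refl (<⇒≢ v<w)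
    vw (inj₂ a)    = SymClosure-sym Edge a
    w≡k,u : level w ≡ k × ∃ λ i → w ≡ u i
    w≡k,u with climb (vw v∈N) v<w
    ... | e , i = ≤-antisym (subst (_≤ k) (sym e) v<k) (k≤w neighbour) , i
    at : (level w ≡ k × ∃ λ i → w ≡ u i) → ∃ λ i → w ≡ u i × toℕ i ≡ k
    at (e , i , refl) = i , refl , e

  Suffix-extend : ∀ {k S i} → toℕ i ≡ k → Suffix (suc k) S → Suffix k (u i ∷ S)
  Suffix-extend {k} {S} {i} refl (u∈ , S≥) = mem , ≤-refl ∷ All.map (≤-trans (n≤1+n _)) S≥
    where
    mem : ∀ {j} → k ≤ toℕ j → u j ∈ (u i ∷ S)
    mem k≤j with m≤n⇒m<n∨m≡n k≤j
    ... | inj₁ k<j = there (u∈ k<j)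
    ... | inj₂ k≡j = here (cong u (toℕ-injective (sym k≡j)))

  Suffix-play-≤ : ∀ f p {k S} → k ≤ m → Suffix (suc k) S → play f p S ≤ k
  Suffix-play-≤ zero    p         k≤m sfx = z≤n
  Suffix-play-≤ (suc f) p {k} {S} k≤m sfx = optimum-≤ (G (suc m)) p
    (All-options (G (suc m)) {S = S} (step k≤m sfx ∘ forced k≤m sfx))
    where
    step : ∀ {k S w} → k ≤ m → Suffix (suc k) S → (0 < k × ∃ λ i → w ≡ u i × toℕ i ≡ k) →
           play f (opponent p) (w ∷ S) < k
    -- Level 0 contradicts `0 < k`: no move is legal there and the game is over.
    step {suc k} k≤m sfx (_ , i , refl , e) =
      s≤s (Suffix-play-≤ f (opponent p) (<⇒≤ k≤m) (Suffix-extend e sfx))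

  last-Suffix : Suffix (suc m) (u (fromℕ (suc m)) ∷ [])
  -- The empty position is a suffix starting beyond the last index, vacuously.
  last-Suffix = Suffix-extend (toℕ-fromℕ _) ((λ {i} l → contradiction (toℕ<n i) (≤⇒≯ l)) , [])

  γcg-≤ : γcg (G (suc m)) ≤ suc m
  γcg-≤ = ≤-trans
    (optimum-dominator-≤ (G (suc m)) (∈-map⁺ _ (∈legalMoves (G (suc m)) {S = []}
      ((u (fromℕ (suc m)) , inj₁ refl , λ ()) , inj₁ refl))))
    -- `pred` gives the cut-off that remains after the opening move.
    (s≤s (Suffix-play-≤ (pred (length (allV (suc m)))) staller ≤-refl last-Suffix))

  -- Ensures that the cut-off in `γcg` leaves room for n moves: the vertices `u i` alone number n +
  -- 1.
  length-allV-≥ : suc m ≤ length (allV (suc m))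
  length-allV-≥ = ≤-trans (n≤1+n _) (≤-trans
    (≤-reflexive (sym (trans (length-map u (allFin (suc (suc m)))) (length-tabulate {n = suc (suc m)} id))))
    (≤-trans (m≤m+n _ _) (≤-reflexive (sym (length-++ (map u (allFin (suc (suc m)))))))))

  γcg-≥ : suc m ≤ γcg (G (suc m))
  γcg-≥ = packing⇒play-≥ (G (suc m)) connected centre centres-disjoint dominator []
    length-allV-≥ (≤-reflexive (+-identityʳ _))

lemma3p3 : (n : ℕ) → 2 ≤ n → γcg (G n) ≡ n
lemma3p3 (suc m) _ = ≤-antisym γcg-≤ γcg-≥
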